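{- For every $n\ge1$, the unimodal spi-logic $\mathsf{SPi}+\{\iota^n_{fun}\}$ is complete.
   Context: Unimodal setting: one diamond $\Diamond$. Sp-formulas: built from propositional variables and $\top$ by $\wedge$ and $\Diamond$; sp-implications $\sigma\to\tau$. A SLO is an algebra $(A,\wedge,\top,\Diamond)$ with $(A,\wedge,\top)$ a meet-semilattice with top and $\Diamond$ monotone; it validates $\sigma\to\tau$ if $\sigma[\mathfrak a]\le\tau[\mathfrak a]$ for all valuations. Frames $(W,R)$ with standard Kripke semantics. $\Sigma\models_{\mathsf{Kr}}\iota$ (resp. $\models_{\mathsf{SLO}}$): $\iota$ valid in every frame (resp. SLO) validating $\Sigma$. The spi-logic $\mathsf{SPi}+\Sigma$ is complete if $\Sigma\models_{\mathsf{Kr}}\iota\iff\Sigma\models_{\mathsf{SLO}}\iota$ for every sp-implication $\iota$. For $P=\{p_0,\dots,p_n\}$, $\iota^n_{fun}=\big(\bigwedge_{Q\subseteq P,|Q|=n}\Diamond\bigwedge Q\to\Diamond\bigwedge P\big)$. -}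

module Defs where

open import Level using (Level; _⊔_; 0ℓ) renaming (suc to lsuc)
open import Data.Nat.Base using (ℕ; zero; suc)
open import Data.Nat.Properties using (_≟_)
open import Data.Fin.Base using (toℕ)
open import Data.Fin.Subset as Subset using (Subset; inside; outside; ∣_∣)
open import Data.Fin.Subset.Properties using (_∈?_)
open import Data.List.Base using (List; []; _∷_; [_]; _++_; map; foldr; filter; allFin)
open import Data.Vec.Base as Vec using ()
open import Data.Product.Base using (_×_; ∃-syntax)
open import Data.Unit.Polymorphic.Base as Unit using ()
open import Function.Bundles using (_⇔_)
open import Relation.Binary.Core using (Rel; _Preserves_⟶_)
open import Relation.Binary.Lattice.Bundles using (BoundedMeetSemilattice)
open import Relation.Unary using (Pred)

infixr 7 _∧_
infix  8 ◇_
infix  5 _⇒_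

data SpFormula : Set where
  var : ℕ → SpFormula
  ⊤   : SpFormula
  _∧_ : SpFormula → SpFormula → SpFormula
  ◇_  : SpFormula → SpFormula

data SpImplication : Set where
  _⇒_ : SpFormula → SpFormula → SpImplication

⋀ : List SpFormula → SpFormula
⋀ = foldr _∧_ ⊤

record Frame (ℓ : Level) : Set (lsuc ℓ) where
  field
    W : Set ℓ
    R : Rel W ℓ

module _ {ℓ} (F : Frame ℓ) where
  open Frame F

  -- Valuations range over all predicates on W at the level of the frame, so
  -- that truth sets of formulas are again possible values of variables.
  Truth : (ℕ → Pred W ℓ) → W → SpFormula → Set ℓ
  Truth V w (var i) = V i w
  Truth V w ⊤       = Unit.⊤
  Truth V w (σ ∧ τ) = Truth V w σ × Truth V w τ
  Truth V w (◇ σ)   = ∃[ v ] (R w v × Truth V v σ)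

  FrameValidates : SpImplication → Set (lsuc ℓ)
  FrameValidates (σ ⇒ τ) = ∀ V w → Truth V w σ → Truth V w τ

record SLO (c ℓ₁ ℓ₂ : Level) : Set (lsuc (c ⊔ ℓ₁ ⊔ ℓ₂)) where
  field
    boundedMeetSemilattice : BoundedMeetSemilattice c ℓ₁ ℓ₂

  open BoundedMeetSemilattice boundedMeetSemilattice public
    using (Carrier; _≈_; _≤_; isBoundedMeetSemilattice)
    renaming (_∧_ to _⊓_; ⊤ to 𝟏)

  field
    dia      : Carrier → Carrier
    dia-mono : dia Preserves _≤_ ⟶ _≤_

module _ {c ℓ₁ ℓ₂} (A : SLO c ℓ₁ ℓ₂) where
  open SLO A

  Value : (ℕ → Carrier) → SpFormula → Carrier
  Value 𝔞 (var i) = 𝔞 i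
  Value 𝔞 ⊤       = 𝟏
  Value 𝔞 (σ ∧ τ) = Value 𝔞 σ ⊓ Value 𝔞 τ
  Value 𝔞 (◇ σ)   = dia (Value 𝔞 σ)

  SLOValidates : SpImplication → Set (c ⊔ ℓ₂)
  SLOValidates (σ ⇒ τ) = ∀ 𝔞 → Value 𝔞 σ ≤ Value 𝔞 τ

KrConsequence : (ℓ : Level) → Pred SpImplication 0ℓ → SpImplication → Set (lsuc ℓ)
KrConsequence ℓ Σ ι =
  (F : Frame ℓ) → (∀ κ → Σ κ → FrameValidates F κ) → FrameValidates F ι

SLOConsequence : (c ℓ₁ ℓ₂ : Level) → Pred SpImplication 0ℓ → SpImplication →
                 Set (lsuc (c ⊔ ℓ₁ ⊔ ℓ₂))
SLOConsequence c ℓ₁ ℓ₂ Σ ι =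
  (A : SLO c ℓ₁ ℓ₂) → (∀ κ → Σ κ → SLOValidates A κ) → SLOValidates A ι

Complete : (ℓ c ℓ₁ ℓ₂ : Level) → Pred SpImplication 0ℓ →
           Set (lsuc (ℓ ⊔ c ⊔ ℓ₁ ⊔ ℓ₂))
Complete ℓ c ℓ₁ ℓ₂ Σ = ∀ ι → KrConsequence ℓ Σ ι ⇔ SLOConsequence c ℓ₁ ℓ₂ Σ ι

subsets : ∀ m → List (Subset m)
subsets zero    = [ Vec.[] ]
subsets (suc m) = map (outside Vec.∷_) (subsets m) ++ map (inside Vec.∷_) (subsets m)

subsetsOfSize : ∀ m → ℕ → List (Subset m)
subsetsOfSize m k = filter (λ Q → ∣ Q ∣ ≟ k) (subsets m)

-- A set Q of variables among p₀, …, pₘ₋₁ is given by its set of indices.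
⋀vars : ∀ {m} → Subset m → SpFormula
⋀vars {m} Q = ⋀ (map (λ i → var (toℕ i)) (filter (_∈? Q) (allFin m)))

ι-fun : ℕ → SpImplication
ι-fun n =
  ⋀ (map (λ Q → ◇ ⋀vars Q) (subsetsOfSize (suc n) n)) ⇒ ◇ ⋀vars (Subset.⊤ {suc n})

{-# OPTIONS --safe #-}

-- Call a formula prime if it is a variable or ◇(β₁ ∧ … ∧ βₖ) with k ≤ n and
-- all βⱼ prime.  The axiom makes ◇ of a meet of more than n formulas
-- equivalent to the meet of the ◇'s obtained by dropping one formula, so every
-- formula is provably equivalent to a finite meet of primes.
-- The primes are also the worlds of a frame: the world ◇(β₁ ∧ … ∧ βₖ) satisfies
-- all variables and sees exactly β₁, …, βₖ; the world p satisfies all variables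
-- but p and sees one extra reflexive world at which everything is true.  No
-- world has more than n successors, no world β satisfies the formula β, and
-- every σ is either true at β or provably below β.  Hence Kripke validity of
-- σ ⇒ τ gives provability of σ ⇒ β for each prime β in the decomposition of τ.

module Submission where

open import Defs
open import Level using (Level; Lift; lift; lower; 0ℓ)
open import Data.Nat.Base using (ℕ; zero; suc; _≤_; _<_; _∸_; _⊓_; z≤n; s≤s; s≤s⁻¹)
open import Data.Nat.Properties using (_≟_; _≤?_; ≰⇒>; m⊓n≤n; m≤n⇒m⊓n≡m; 1+n≰n)
open import Data.Fin.Base using (Fin; zero; suc; toℕ; fromℕ<; inject≤; punchIn; punchOut)
open import Data.Fin.Properties using (toℕ-injective; toℕ-fromℕ<; toℕ-inject≤; toℕ≤pred[n]; punchIn-punchOut; pigeonhole; <⇒≢; ¬∀⟶∃¬) renaming (_≟_ to _≟ᶠ_)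
open import Data.Fin.Subset as Subset using (Subset; inside; outside; ∣_∣; ∁; ⁅_⁆)
open import Data.Fin.Subset.Properties using (_∈?_; ∈⊤; ∣⊤∣≡n; p⊆q⇒∣p∣≤∣q∣; ∣∁p∣≡n∸∣p∣; ∣⁅x⁆∣≡1; x∈⁅y⁆⇒x≡y; x∉p⇒x∈∁p)
open import Data.List.Base using (List; []; _∷_; [_]; _++_; map; filter; allFin; lookup; length)
open import Data.List.Properties using (map-∘; map-tabulate; tabulate-lookup)
open import Data.List.Membership.Propositional using (_∈_)
open import Data.List.Membership.Propositional.Properties using (∈-map⁺; ∈-filter⁺; ∈-filter⁻; ∈-allFin; ∈-++⁺ˡ; ∈-++⁺ʳ)
open import Data.List.Relation.Unary.Any using (here; there)
open import Data.Maybe.Base using (Maybe; just; nothing)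
open import Data.Product.Base using (_×_; _,_; ∃-syntax; proj₁; proj₂)
open import Data.Sum.Base using (_⊎_; inj₁; inj₂)
open import Data.Unit.Polymorphic.Base as Unit using (tt)
open import Data.Vec.Base as Vec using ()
open import Function.Base using (_∘_; id)
open import Function.Bundles using (mk⇔)
open import Relation.Binary.PropositionalEquality using (_≡_; _≢_; refl; sym; trans; cong; cong₂; subst; subst₂)
open import Relation.Nullary.Decidable using (yes; no)
open import Relation.Nullary.Negation using (¬_; contradiction)
open import Relation.Binary.Lattice.Structures using (IsBoundedMeetSemilattice)
open import Relation.Unary using (Pred; ｛_｝)

-- Finite alternatives and subsets of size n.

∀⊎∃ : ∀ {p q} {k} {P : Pred (Fin k) p} {Q : Pred (Fin k) q} →
      (∀ j → P j ⊎ Q j) → (∀ j → P j) ⊎ ∃[ j ] Q j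
∀⊎∃ {k = zero}  h = inj₁ λ ()
∀⊎∃ {k = suc k} h with h zero | ∀⊎∃ (h ∘ suc)
... | inj₂ q | _            = inj₂ (zero , q)
... | inj₁ p | inj₂ (j , q) = inj₂ (suc j , q)
... | inj₁ p | inj₁ ps      = inj₁ λ { zero → p ; (suc j) → ps j }

∈-subsets : ∀ {m} (Q : Subset m) → Q ∈ subsets m
∈-subsets Vec.[]            = here refl
∈-subsets (outside Vec.∷ Q) = ∈-++⁺ˡ (∈-map⁺ _ (∈-subsets Q))
∈-subsets (inside  Vec.∷ Q) = ∈-++⁺ʳ _ (∈-map⁺ _ (∈-subsets Q))

∁⁅i⁆∈subsetsOfSize : ∀ {n} (i : Fin (suc n)) → ∁ ⁅ i ⁆ ∈ subsetsOfSize (suc n) n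
∁⁅i⁆∈subsetsOfSize {n} i = ∈-filter⁺ (λ Q → ∣ Q ∣ ≟ n) (∈-subsets (∁ ⁅ i ⁆))
  (trans (∣∁p∣≡n∸∣p∣ ⁅ i ⁆) (cong (suc n ∸_) (∣⁅x⁆∣≡1 i)))

-- If Q contained every index, its size would be n + 1. In derivations the missing index selects the
-- formula that proves the conjunct of the axiom belonging to Q.
∣Q∣≡n⇒∃∉ : ∀ {n} (Q : Subset (suc n)) → ∣ Q ∣ ≡ n → ∃[ i ] (i Subset.∉ Q)
∣Q∣≡n⇒∃∉ {n} Q ∣Q∣≡n = ¬∀⟶∃¬ (suc n) (Subset._∈ Q) (_∈? Q) λ all →
  1+n≰n (subst₂ _≤_ (∣⊤∣≡n (suc n)) ∣Q∣≡n (p⊆q⇒∣p∣≤∣q∣ {p = Subset.⊤} λ {x} _ → all x))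

-- Substitution, and a calculus with its soundness and algebraic completeness.

sub : (ℕ → SpFormula) → SpFormula → SpFormula
sub s (var i) = s i
sub s ⊤       = ⊤
sub s (σ ∧ τ) = sub s σ ∧ sub s τ
sub s (◇ σ)   = ◇ sub s σ

sub-var : ∀ σ → sub var σ ≡ σ
sub-var (var i) = refl
sub-var ⊤       = refl
sub-var (σ ∧ τ) = cong₂ _∧_ (sub-var σ) (sub-var τ)
sub-var (◇ σ)   = cong ◇_ (sub-var σ)

sub-⋀ : ∀ {a} {A : Set a} s (g : A → SpFormula) L →
        sub s (⋀ (map g L)) ≡ ⋀ (map (sub s ∘ g) L)
sub-⋀ s g []      = refl
sub-⋀ s g (x ∷ L) = cong (sub s (g x) ∧_) (sub-⋀ s g L)

module Calculus (Σ : Pred SpImplication 0ℓ) where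

  infix 4 _⊢_ _⊣⊢_

  -- Derivability in the spi-logic. Substitution enters only through `axiom`, so soundness is an
  -- induction that meets it in a single case.
  data _⊢_ : SpFormula → SpFormula → Set where
    ⊢-refl  : ∀ {σ} → σ ⊢ σ
    ⊢-trans : ∀ {ρ σ τ} → ρ ⊢ σ → σ ⊢ τ → ρ ⊢ τ
    ⊤-max   : ∀ {σ} → σ ⊢ ⊤
    ∧-fst   : ∀ {σ τ} → σ ∧ τ ⊢ σ
    ∧-snd   : ∀ {σ τ} → σ ∧ τ ⊢ τ
    ∧-intro : ∀ {ρ σ τ} → ρ ⊢ σ → ρ ⊢ τ → ρ ⊢ σ ∧ τ
    ◇-mono  : ∀ {σ τ} → σ ⊢ τ → ◇ σ ⊢ ◇ τ
    axiom   : ∀ {σ τ} → Σ (σ ⇒ τ) → ∀ s → sub s σ ⊢ sub s τ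

  _⊣⊢_ : SpFormula → SpFormula → Set
  σ ⊣⊢ τ = σ ⊢ τ × τ ⊢ σ

  ⊢-reflexive : ∀ {σ τ} → σ ≡ τ → σ ⊢ τ
  ⊢-reflexive refl = ⊢-refl

  ⋀-intro : ∀ {a} {A : Set a} {σ} {g : A → SpFormula} L →
            (∀ {x} → x ∈ L → σ ⊢ g x) → σ ⊢ ⋀ (map g L)
  ⋀-intro []      h = ⊤-max
  ⋀-intro (x ∷ L) h = ∧-intro (h (here refl)) (⋀-intro L (h ∘ there))

  ⋀-elim : ∀ {a} {A : Set a} {g : A → SpFormula} {L x} →
           x ∈ L → ⋀ (map g L) ⊢ g x
  ⋀-elim (here refl) = ∧-fst
  ⋀-elim (there x∈L) = ⊢-trans ∧-snd (⋀-elim x∈L)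

  module _ {ℓ} (F : Frame ℓ) where
    open Frame F

    module _ (V : ℕ → Pred W ℓ) (s : ℕ → SpFormula) where

      -- Substituting s amounts to valuing each variable by the truth set of its image. Soundness of
      -- `axiom` uses both directions.
      Truth-sub⁻ : ∀ {w} σ → Truth F V w (sub s σ) → Truth F (λ i v → Truth F V v (s i)) w σ
      Truth-sub⁻ (var i) t             = t
      Truth-sub⁻ ⊤       t             = tt
      Truth-sub⁻ (σ ∧ τ) (t , u)       = Truth-sub⁻ σ t , Truth-sub⁻ τ u
      Truth-sub⁻ (◇ σ)   (v , wRv , t) = v , wRv , Truth-sub⁻ σ t

      Truth-sub⁺ : ∀ {w} σ → Truth F (λ i v → Truth F V v (s i)) w σ → Truth F V w (sub s σ)
      Truth-sub⁺ (var i) t             = t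
      Truth-sub⁺ ⊤       t             = tt
      Truth-sub⁺ (σ ∧ τ) (t , u)       = Truth-sub⁺ σ t , Truth-sub⁺ τ u
      Truth-sub⁺ (◇ σ)   (v , wRv , t) = v , wRv , Truth-sub⁺ σ t

    frame-sound : (∀ κ → Σ κ → FrameValidates F κ) →
                  ∀ {σ τ} → σ ⊢ τ → FrameValidates F (σ ⇒ τ)
    frame-sound h ⊢-refl        V w t             = t
    frame-sound h (⊢-trans d e) V w t             = frame-sound h e V w (frame-sound h d V w t)
    frame-sound h ⊤-max         V w t             = tt
    frame-sound h ∧-fst         V w t             = proj₁ t
    frame-sound h ∧-snd         V w t             = proj₂ t
    frame-sound h (∧-intro d e) V w t             = frame-sound h d V w t , frame-sound h e V w t
    frame-sound h (◇-mono d)    V w (v , wRv , t) = v , wRv , frame-sound h d V v t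
    frame-sound h (axiom {σ} {τ} ax s) V w t      =
      Truth-sub⁺ V s τ (h _ ax _ w (Truth-sub⁻ V s σ t))

  module _ {c ℓ₁ ℓ₂} (A : SLO c ℓ₁ ℓ₂) where
    open SLO A renaming (_≤_ to _≼_; _⊓_ to _⊓ᴬ_)
    private module S = IsBoundedMeetSemilattice isBoundedMeetSemilattice

    Value-sub : ∀ 𝔞 s σ → Value A 𝔞 (sub s σ) ≡ Value A (Value A 𝔞 ∘ s) σ
    Value-sub 𝔞 s (var i) = refl
    Value-sub 𝔞 s ⊤       = refl
    Value-sub 𝔞 s (σ ∧ τ) = cong₂ _⊓ᴬ_ (Value-sub 𝔞 s σ) (Value-sub 𝔞 s τ)
    Value-sub 𝔞 s (◇ σ)   = cong dia (Value-sub 𝔞 s σ)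

    slo-sound : (∀ κ → Σ κ → SLOValidates A κ) →
                ∀ {σ τ} → σ ⊢ τ → SLOValidates A (σ ⇒ τ)
    slo-sound h ⊢-refl        𝔞 = S.refl
    slo-sound h (⊢-trans d e) 𝔞 = S.trans (slo-sound h d 𝔞) (slo-sound h e 𝔞)
    slo-sound h ⊤-max         𝔞 = S.maximum _
    slo-sound h ∧-fst         𝔞 = S.x∧y≤x _ _
    slo-sound h ∧-snd         𝔞 = S.x∧y≤y _ _
    slo-sound h (∧-intro d e) 𝔞 = S.∧-greatest (slo-sound h d 𝔞) (slo-sound h e 𝔞)
    slo-sound h (◇-mono d)    𝔞 = dia-mono (slo-sound h d 𝔞)
    slo-sound h (axiom {σ} {τ} ax s) 𝔞 =
      subst₂ _≼_ (sym (Value-sub 𝔞 s σ)) (sym (Value-sub 𝔞 s τ)) (h _ ax (Value A 𝔞 ∘ s))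

  module _ (c ℓ₁ ℓ₂ : Level) where

    -- The Lindenbaum algebra, with interderivability as its equality instead of a quotient. Lifting
    -- places it at arbitrary universe levels.
    lindenbaum : SLO c ℓ₁ ℓ₂
    lindenbaum = record
      { boundedMeetSemilattice = record
        { Carrier = Lift c SpFormula
        ; _≈_     = λ σ τ → Lift ℓ₁ (lower σ ⊣⊢ lower τ)
        ; _≤_     = λ σ τ → Lift ℓ₂ (lower σ ⊢ lower τ)
        ; _∧_     = λ σ τ → lift (lower σ ∧ lower τ)
        ; ⊤       = lift ⊤
        ; isBoundedMeetSemilattice = record
          { isMeetSemilattice = record
            { isPartialOrder = record
              { isPreorder = record
                { isEquivalence = record
                  { refl  = lift (⊢-refl , ⊢-refl)
                  ; sym   = λ (lift (d , e)) → lift (e , d)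
                  ; trans = λ (lift (d , e)) (lift (d′ , e′)) →
                              lift (⊢-trans d d′ , ⊢-trans e′ e)
                  }
                ; reflexive = λ (lift (d , _)) → lift d
                ; trans     = λ (lift d) (lift e) → lift (⊢-trans d e)
                }
              ; antisym = λ (lift d) (lift e) → lift (d , e)
              }
            ; infimum = λ _ _ → lift ∧-fst , lift ∧-snd ,
                                λ _ (lift d) (lift e) → lift (∧-intro d e)
            }
          ; maximum = λ _ → lift ⊤-max
          }
        }
      ; dia      = λ σ → lift (◇ lower σ)
      ; dia-mono = λ (lift d) → lift (◇-mono d)
      }

    Value-lindenbaum : ∀ 𝔞 σ → lower (Value lindenbaum 𝔞 σ) ≡ sub (lower ∘ 𝔞) σ
    Value-lindenbaum 𝔞 (var i) = refl
    Value-lindenbaum 𝔞 ⊤       = refl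
    Value-lindenbaum 𝔞 (σ ∧ τ) = cong₂ _∧_ (Value-lindenbaum 𝔞 σ) (Value-lindenbaum 𝔞 τ)
    Value-lindenbaum 𝔞 (◇ σ)   = cong ◇_ (Value-lindenbaum 𝔞 σ)

    lindenbaum-validates : ∀ κ → Σ κ → SLOValidates lindenbaum κ
    lindenbaum-validates (σ ⇒ τ) ax 𝔞 = lift
      (subst₂ _⊢_ (sym (Value-lindenbaum 𝔞 σ)) (sym (Value-lindenbaum 𝔞 τ))
              (axiom ax (lower ∘ 𝔞)))

    slo-complete : ∀ {σ τ} → SLOConsequence c ℓ₁ ℓ₂ Σ (σ ⇒ τ) → σ ⊢ τ
    slo-complete {σ} {τ} h =
      subst₂ _⊢_ (trans (Value-lindenbaum 𝔦 σ) (sub-var σ))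
                 (trans (Value-lindenbaum 𝔦 τ) (sub-var τ))
             -- Under the identity valuation every formula denotes itself, so the order of the
             -- algebra is derivability.
             (lower (h lindenbaum lindenbaum-validates 𝔦))
      where
      𝔦 : ℕ → Lift c SpFormula
      𝔦 i = lift (var i)

-- Frames with finitely many enumerated successors.

module Branching {ℓ} {W : Set ℓ} (arity : W → ℕ) (next : ∀ w → Fin (arity w) → W) where

  branching : Frame ℓ
  branching = record { W = W ; R = λ w v → ∃[ j ] next w j ≡ v }

  module _ (V : ℕ → Pred W ℓ) where

    Truth-⋀⁺ : ∀ {a} {A : Set a} {w} (g : A → SpFormula) L →
               (∀ {x} → x ∈ L → Truth branching V w (g x)) → Truth branching V w (⋀ (map g L))
    Truth-⋀⁺ g []      h = tt
    Truth-⋀⁺ g (x ∷ L) h = h (here refl) , Truth-⋀⁺ g L (h ∘ there)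

    Truth-⋀⁻ : ∀ {a} {A : Set a} {w} (g : A → SpFormula) {L x} →
               x ∈ L → Truth branching V w (⋀ (map g L)) → Truth branching V w (g x)
    Truth-⋀⁻ g (here refl) (t , _) = t
    Truth-⋀⁻ g (there x∈L) (_ , t) = Truth-⋀⁻ g x∈L t

  -- The conjunct for the complement of i yields a successor at which every variable except possibly
  -- the i-th holds. There are n + 1 indices but at most n successors, so two indices share a
  -- successor, and there all variables hold.
  branching-validates-ι-fun : ∀ {n} → (∀ w → arity w ≤ n) → FrameValidates branching (ι-fun n)
  branching-validates-ι-fun {n} arity≤n V w t = conclude (pigeonhole (s≤s (arity≤n w)) (proj₁ ∘ witness))
    where
    witness : ∀ i → ∃[ j ] (∀ k → k ≢ i → V (toℕ k) (next w j))
    witness i with Truth-⋀⁻ V {w = w} (λ Q → ◇ ⋀vars Q) (∁⁅i⁆∈subsetsOfSize i) t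
    ... | _ , (j , refl) , u = j , λ k k≢i →
      Truth-⋀⁻ V (λ k → var (toℕ k)) (∈-filter⁺ (_∈? ∁ ⁅ i ⁆) (∈-allFin k) (x∉p⇒x∈∁p (k≢i ∘ x∈⁅y⁆⇒x≡y i))) u

    conclude : ∃[ i ] ∃[ i′ ] (toℕ i < toℕ i′ × proj₁ (witness i) ≡ proj₁ (witness i′)) →
               Truth branching V w (◇ ⋀vars (Subset.⊤ {suc n}))
    conclude (i , i′ , i<i′ , eq) = next w (proj₁ (witness i)) , (_ , refl) ,
      Truth-⋀⁺ V (λ k → var (toℕ k)) (filter (_∈? Subset.⊤) (allFin (suc n))) λ {k} _ → holds k
      where
      holds : ∀ k → V (toℕ k) (next w (proj₁ (witness i)))
      holds k with k ≟ᶠ i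
      ... | no  k≢i  = proj₂ (witness i) k k≢i
      -- The variable that may be missing for i is supplied by i′, which differs from i.
      ... | yes refl = subst (V (toℕ k) ∘ next w) (sym eq) (proj₂ (witness i′) k (<⇒≢ i<i′))

-- Decomposition of formulas into primes.

module Primes (n : ℕ) where

  open Calculus ｛ ι-fun n ｝ public

  -- The axiom applied to the formulas ⋀ {f k : c k = i}, for i ≤ n.
  merge : ∀ {m} (c : Fin m → ℕ) → (∀ k → c k ≤ n) →
          (f : Fin m → SpFormula) (y : Fin (suc n) → SpFormula) →
          (∀ i k → c k ≢ toℕ i → y i ⊢ f k) →
          ⋀ (map (λ i → ◇ y i) (allFin (suc n))) ⊢ ◇ ⋀ (map f (allFin m))
  merge {m} c c≤n f y y⊢f = ⊢-trans premise (⊢-trans (axiom refl s) (◇-mono conclusion))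
    where
    class : ℕ → List (Fin m)
    class a = filter (λ k → c k ≟ a) (allFin m)

    s : ℕ → SpFormula
    s a = ⋀ (map f (class a))

    -- The formula `y i` proves every class but possibly its own, hence all conjuncts of an instance
    -- that omits i.
    y⊢s : ∀ i j → j ≢ i → y i ⊢ s (toℕ j)
    y⊢s i j j≢i = ⋀-intro (class (toℕ j)) λ {k} k∈ → y⊢f i k λ ck≡i →
      j≢i (toℕ-injective (trans (sym (proj₂ (∈-filter⁻ (λ k → c k ≟ toℕ j) {xs = allFin m} k∈))) ck≡i))

    y⊢vars : ∀ i Q → i Subset.∉ Q → y i ⊢ sub s (⋀vars Q)
    y⊢vars i Q i∉Q = ⊢-trans
      (⋀-intro (filter (_∈? Q) (allFin (suc n))) λ {j} j∈ → y⊢s i j λ { refl →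
        i∉Q (proj₂ (∈-filter⁻ (_∈? Q) {xs = allFin (suc n)} j∈)) })
      (⊢-reflexive (sym (sub-⋀ s (λ i → var (toℕ i)) (filter (_∈? Q) (allFin (suc n))))))

    ⊢◇vars : ∀ Q → ∃[ i ] (i Subset.∉ Q) →
             ⋀ (map (λ i → ◇ y i) (allFin (suc n))) ⊢ sub s (◇ ⋀vars Q)
    ⊢◇vars Q (i , i∉Q) = ⊢-trans (⋀-elim (∈-allFin i)) (◇-mono (y⊢vars i Q i∉Q))

    premise : ⋀ (map (λ i → ◇ y i) (allFin (suc n))) ⊢
              sub s (⋀ (map (λ Q → ◇ ⋀vars Q) (subsetsOfSize (suc n) n)))
    premise = ⊢-trans
      (⋀-intro (subsetsOfSize (suc n) n) λ {Q} Q∈ →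
        ⊢◇vars Q (∣Q∣≡n⇒∃∉ Q (proj₂ (∈-filter⁻ (λ Q → ∣ Q ∣ ≟ n) {xs = subsets (suc n)} Q∈))))
      (⊢-reflexive (sym (sub-⋀ s (λ Q → ◇ ⋀vars Q) (subsetsOfSize (suc n) n))))

    all : List (Fin (suc n))
    all = filter (_∈? Subset.⊤) (allFin (suc n))

    vars⊢s : ∀ a → a ≤ n → sub s (⋀vars (Subset.⊤ {suc n})) ⊢ s a
    vars⊢s a a≤n = ⊢-trans (⊢-reflexive (sub-⋀ s (λ i → var (toℕ i)) all))
      (subst (λ b → ⋀ (map (λ i → s (toℕ i)) all) ⊢ s b) (toℕ-fromℕ< (s≤s a≤n))
        (⋀-elim (∈-filter⁺ (_∈? Subset.⊤) (∈-allFin (fromℕ< (s≤s a≤n))) ∈⊤)))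

    -- The bound on c makes the classes 0, ..., n exhaust the family f.
    conclusion : sub s (⋀vars (Subset.⊤ {suc n})) ⊢ ⋀ (map f (allFin m))
    conclusion = ⋀-intro (allFin m) λ {k} _ → ⊢-trans (vars⊢s (c k) (c≤n k))
      (⋀-elim (∈-filter⁺ (λ k′ → c k′ ≟ c k) (∈-allFin k) refl))

  -- Components are a function on `Fin k`, so they serve directly as the enumerated successors of a
  -- world and allow structural recursion.
  data Prime : Set where
    var : ℕ → Prime
    dia : ∀ {k} → k ≤ n → (Fin k → Prime) → Prime

  ⌜_⌝ : Prime → SpFormula
  ⌜ var i ⌝       = var i
  ⌜ dia {k} _ f ⌝ = ◇ ⋀ (map (λ j → ⌜ f j ⌝) (allFin k))

  Decomposable : SpFormula → Set
  Decomposable τ = ∃[ L ] (τ ⊣⊢ ⋀ (map ⌜_⌝ L))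

  decomposable-resp : ∀ {σ τ} → σ ⊣⊢ τ → Decomposable τ → Decomposable σ
  decomposable-resp (d , e) (L , d′ , e′) = L , ⊢-trans d d′ , ⊢-trans e′ e

  decomposable-prime : ∀ β → Decomposable ⌜ β ⌝
  decomposable-prime β = [ β ] , ∧-intro ⊢-refl ⊤-max , ∧-fst

  ⋀-++ : ∀ L M → ⋀ (map ⌜_⌝ (L ++ M)) ⊣⊢ ⋀ (map ⌜_⌝ L) ∧ ⋀ (map ⌜_⌝ M)
  ⋀-++ []      M = ∧-intro ⊤-max ⊢-refl , ∧-snd
  ⋀-++ (β ∷ L) M with ⋀-++ L M
  ... | d , e =
    ∧-intro (∧-intro ∧-fst (⊢-trans ∧-snd (⊢-trans d ∧-fst))) (⊢-trans ∧-snd (⊢-trans d ∧-snd)) ,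
    ∧-intro (⊢-trans ∧-fst ∧-fst) (⊢-trans (∧-intro (⊢-trans ∧-fst ∧-snd) ∧-snd) e)

  decomposable-∧ : ∀ {σ τ} → Decomposable σ → Decomposable τ → Decomposable (σ ∧ τ)
  decomposable-∧ (L , d , e) (M , d′ , e′) = L ++ M ,
    ⊢-trans (∧-intro (⊢-trans ∧-fst d) (⊢-trans ∧-snd d′)) (proj₂ (⋀-++ L M)) ,
    ⊢-trans (proj₁ (⋀-++ L M)) (∧-intro (⊢-trans ∧-fst e) (⊢-trans ∧-snd e′))

  decomposable-⊤ : Decomposable ⊤
  decomposable-⊤ = [] , ⊢-refl , ⊢-refl

  decomposable-⋀ : ∀ {a} {A : Set a} {g : A → SpFormula} L →
                   (∀ x → Decomposable (g x)) → Decomposable (⋀ (map g L))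
  decomposable-⋀ []      h = decomposable-⊤
  decomposable-⋀ (x ∷ L) h = decomposable-∧ (h x) (decomposable-⋀ L h)

  -- Only the first n + 1 of the m + 1 formulas are dropped in turn, one for each conjunct of the
  -- axiom. Left to right is monotonicity; right to left is the axiom.
  ◇⋀-drop-one : ∀ {m} (n≤m : n ≤ m) (f : Fin (suc m) → SpFormula) →
    ◇ ⋀ (map f (allFin (suc m))) ⊣⊢
    ⋀ (map (λ i → ◇ ⋀ (map (f ∘ punchIn (inject≤ i (s≤s n≤m))) (allFin m))) (allFin (suc n)))
  ◇⋀-drop-one {m} n≤m f =
    ⋀-intro (allFin (suc n)) (λ _ → ◇-mono (⋀-intro (allFin m) λ {k} _ →
      ⋀-elim {g = f} (∈-allFin (punchIn _ k)))) ,
    -- The classes below n are singletons; class n collects all remaining indices.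
    merge (λ k → toℕ k ⊓ n) (λ k → m⊓n≤n (toℕ k) n) f _ rest⊢
    where
    rest⊢ : ∀ i k → toℕ k ⊓ n ≢ toℕ i →
            ⋀ (map (f ∘ punchIn (inject≤ i (s≤s n≤m))) (allFin m)) ⊢ f k
    rest⊢ i k k⊓n≢i = subst (λ k′ → ⋀ (map (f ∘ punchIn _) (allFin m)) ⊢ f k′)
      (punchIn-punchOut i≢k) (⋀-elim (∈-allFin (punchOut i≢k)))
      where
      i≢k : inject≤ i (s≤s n≤m) ≢ k
      -- An index i ≤ n lies in class i, so anything outside that class survives dropping i.
      i≢k refl = k⊓n≢i (trans (cong (_⊓ n) (toℕ-inject≤ i (s≤s n≤m))) (m≤n⇒m⊓n≡m (toℕ≤pred[n] i)))

  -- Induction on the number of conjuncts: above n, each meet with one formula dropped is shorter.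
  decomposable-◇⋀ : ∀ m (f : Fin m → Prime) → Decomposable (◇ ⋀ (map (⌜_⌝ ∘ f) (allFin m)))
  decomposable-◇⋀ zero    f = decomposable-prime (dia z≤n f)
  decomposable-◇⋀ (suc m) f with suc m ≤? n
  ... | yes 1+m≤n = decomposable-prime (dia 1+m≤n f)
  ... | no  1+m≰n = decomposable-resp (◇⋀-drop-one (s≤s⁻¹ (≰⇒> 1+m≰n)) (⌜_⌝ ∘ f))
    (decomposable-⋀ (allFin (suc n)) λ i → decomposable-◇⋀ m (f ∘ punchIn _))

  decomposable-◇ : ∀ {τ} → Decomposable τ → Decomposable (◇ τ)
  decomposable-◇ (L , d , e) = decomposable-resp (◇-mono d , ◇-mono e)
    (subst (λ ρs → Decomposable (◇ ⋀ ρs)) map-lookup (decomposable-◇⋀ (length L) (lookup L)))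
    where
    map-lookup : map (⌜_⌝ ∘ lookup L) (allFin (length L)) ≡ map ⌜_⌝ L
    map-lookup = trans (map-∘ (allFin (length L)))
      (cong (map ⌜_⌝) (trans (map-tabulate id (lookup L)) (tabulate-lookup L)))

  decompose : ∀ τ → Decomposable τ
  decompose (var i) = decomposable-prime (var i)
  decompose ⊤       = decomposable-⊤
  decompose (σ ∧ τ) = decomposable-∧ (decompose σ) (decompose τ)
  decompose (◇ τ)   = decomposable-◇ (decompose τ)

-- The frame of primes and completeness.

module Canonical (n : ℕ) (1≤n : 1 ≤ n) (ℓ : Level) where

  open Primes n

  -- nothing is the reflexive world at which every formula is true.
  World : Set ℓ
  World = Lift ℓ (Maybe Prime)

  ⟨_⟩ : Prime → World
  ⟨ β ⟩ = lift (just β)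

  arity : World → ℕ
  arity (lift nothing)              = 1
  arity (lift (just (var _)))       = 1
  arity (lift (just (dia {k} _ _))) = k

  next : ∀ w → Fin (arity w) → World
  next (lift nothing)          _ = lift nothing
  next (lift (just (var _)))   _ = lift nothing
  next (lift (just (dia _ f))) j = ⟨ f j ⟩

  arity≤n : ∀ w → arity w ≤ n
  -- The single successor of the full world, and of a variable world, fits the bound because n is at
  -- least 1.
  arity≤n (lift nothing)              = 1≤n
  arity≤n (lift (just (var _)))       = 1≤n
  arity≤n (lift (just (dia k≤n _)))   = k≤n

  open Branching arity next

  V : ℕ → Pred World ℓ
  V i (lift nothing)          = Unit.⊤
  V i (lift (just (var q)))   = Lift ℓ (i ≢ q)
  V i (lift (just (dia _ _))) = Unit.⊤

  infix 4 _⊨_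
  _⊨_ : World → SpFormula → Set ℓ
  _⊨_ = Truth branching V

  full⊨ : ∀ σ → lift nothing ⊨ σ
  full⊨ (var i) = tt
  full⊨ ⊤       = tt
  full⊨ (σ ∧ τ) = full⊨ σ , full⊨ τ
  full⊨ (◇ σ)   = lift nothing , (zero , refl) , full⊨ σ

  -- A successor witnessing `⌜ β ⌝` at its own world would be a component satisfying all components,
  -- itself included; induction excludes this.
  ⊭-self : ∀ β → ¬ (⟨ β ⟩ ⊨ ⌜ β ⌝)
  ⊭-self (var i)   (lift i≢i)           = i≢i refl
  ⊭-self (dia _ f) (_ , (j , refl) , t) = ⊭-self (f j) (Truth-⋀⁻ V (λ i → ⌜ f i ⌝) (∈-allFin j) t)

  -- A disjunction proved by recursion, so no excluded middle is used. For a diamond at a compound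
  -- prime, either some component satisfies σ, or σ proves all components and monotonicity applies.
  -- At a variable world every diamond is true through the full world.
  ⊢-or-⊨ : ∀ σ β → σ ⊢ ⌜ β ⌝ ⊎ ⟨ β ⟩ ⊨ σ
  ⊢-or-⊨ (var i) (var q) with i ≟ q
  ... | yes refl = inj₁ ⊢-refl
  ... | no  i≢q  = inj₂ (lift i≢q)
  ⊢-or-⊨ (var i) (dia _ _) = inj₂ tt
  ⊢-or-⊨ ⊤       β         = inj₂ tt
  ⊢-or-⊨ (σ ∧ τ) β with ⊢-or-⊨ σ β | ⊢-or-⊨ τ β
  ... | inj₁ d | _      = inj₁ (⊢-trans ∧-fst d)
  ... | inj₂ _ | inj₁ d = inj₁ (⊢-trans ∧-snd d)
  ... | inj₂ t | inj₂ u = inj₂ (t , u)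
  ⊢-or-⊨ (◇ σ) (var q) = inj₂ (lift nothing , (zero , refl) , full⊨ σ)
  ⊢-or-⊨ (◇ σ) (dia {k} _ f) with ∀⊎∃ (λ j → ⊢-or-⊨ σ (f j))
  ... | inj₁ d       = inj₁ (◇-mono (⋀-intro (allFin k) λ {j} _ → d j))
  ... | inj₂ (j , t) = inj₂ (_ , (j , refl) , t)

  validates : ∀ κ → ｛ ι-fun n ｝ κ → FrameValidates branching κ
  validates _ refl = branching-validates-ι-fun arity≤n

  kripke-complete : ∀ {σ τ} → KrConsequence ℓ ｛ ι-fun n ｝ (σ ⇒ τ) → σ ⊢ τ
  kripke-complete {σ} {τ} h with decompose τ
  ... | L , τ⊢L , L⊢τ = ⊢-trans (⋀-intro L σ⊢) L⊢τ
    where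
    σ⊢ : ∀ {β} → β ∈ L → σ ⊢ ⌜ β ⌝
    σ⊢ {β} β∈L with ⊢-or-⊨ σ β
    ... | inj₁ d = d
    -- Truth of σ at β would pass to τ by validity, and then to β by soundness.
    ... | inj₂ t = contradiction
      (frame-sound branching validates (⊢-trans τ⊢L (⋀-elim β∈L)) V ⟨ β ⟩
        (h branching validates V ⟨ β ⟩ t))
      (⊭-self β)

theorem7p3 : ∀ {ℓ c ℓ₁ ℓ₂} (n : ℕ) → 1 ≤ n → Complete ℓ c ℓ₁ ℓ₂ ｛ ι-fun n ｝
theorem7p3 {ℓ} {c} {ℓ₁} {ℓ₂} n 1≤n (σ ⇒ τ) = mk⇔
  -- Derivability mediates between the two consequence relations in both directions.
  (λ h A A⊨ι → slo-sound A A⊨ι (kripke-complete {σ} {τ} h))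
  (λ h F F⊨ι → frame-sound F F⊨ι (slo-complete c ℓ₁ ℓ₂ {σ} {τ} h))
  where
  open Calculus ｛ ι-fun n ｝
  open Canonical n 1≤n ℓ
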